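{- Let $h\ge 1$ and let $a_1,\dots,a_h$ be non-zero integers, and let $\mathscr{L}$ denote the linear form $a_1x_1+\cdots+a_hx_h$. (i) There exists a unique representation $\mathscr{L}$-basis (that is, a set $A\subseteq\mathbb{Z}$ with $f_{A,\mathscr{L}}(n)=1$ for every $n\in\mathbb{Z}$) if and only if $\mathscr{L}$ is primitive, i.e. $\gcd(a_1,\dots,a_h)=1$. (ii) The following are equivalent: (a) $\mathscr{L}$ is primitive and not all of the $a_i$ have the same sign; (b) for every $n\in\mathbb{Z}$ there exists a unique representation $\mathscr{L}$-basis $A(n)$ with $A(n)\subseteq[n,+\infty)$.
   Context: For $A\subseteq\mathbb{Z}$ and $n\in\mathbb{Z}$, a representation of $n$ by $\mathscr{L}$ (in $A$) is an $h$-tuple $(x_1,\dots,x_h)\in A^h$ with $a_1x_1+\cdots+a_hx_h=n$. Two representations $(x_1,\dots,x_h)$ and $(y_1,\dots,y_h)$ of the same integer $n$ are called equivalent if for every $\xi\in\mathbb{Z}$, $\sum_{i:\,x_i=\xi}a_i=\sum_{i:\,y_i=\xi}a_i$. The (unordered) representation function $f_{A,\mathscr{L}}(n)\in\mathbb{N}_0\cup\{\infty\}$ is the number of equivalence classes of representations of $n$ by $\mathscr{L}$ in $A$. -}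

module Defs where

open import Data.Nat using (ℕ; zero; suc)
import Data.Nat.GCD as NG
open import Data.Integer using (ℤ; 0ℤ; _+_; _*_; _<_; ∣_∣)
open import Data.Integer.Properties using (_≟_)
open import Data.Fin using (Fin; zero; suc)
open import Data.Product using (Σ; ∃; _×_; _,_)
open import Data.Sum using (_⊎_)
open import Relation.Nullary using (¬_; yes; no)
open import Relation.Binary.PropositionalEquality using (_≡_)
open import Level using (0ℓ)
open import Relation.Unary using (Pred)

sumFin : ∀ {h} → (Fin h → ℤ) → ℤ
sumFin {zero} f = 0ℤ
sumFin {suc h} f = f zero + sumFin (λ i → f (suc i))

linForm : ∀ {h} → (Fin h → ℤ) → (Fin h → ℤ) → ℤ
linForm a x = sumFin (λ i → a i * x i)

IsRep : ∀ {h} → (Fin h → ℤ) → Pred ℤ 0ℓ → ℤ → (Fin h → ℤ) → Set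
IsRep a A n x = (∀ i → A (x i)) × linForm a x ≡ n

weight : ∀ {h} → (Fin h → ℤ) → (Fin h → ℤ) → ℤ → ℤ
weight a x ξ = sumFin (λ i → sel i)
  where
  sel : _ → ℤ
  sel i with x i ≟ ξ
  ... | yes _ = a i
  ... | no  _ = 0ℤ

RepEquiv : ∀ {h} → (Fin h → ℤ) → (Fin h → ℤ) → (Fin h → ℤ) → Set
RepEquiv a x y = ∀ ξ → weight a x ξ ≡ weight a y ξ

-- f_{A,L}(n) = 1: there is a representation, and any two are equivalent
-- (i.e. exactly one equivalence class of representations)
RepFunOne : ∀ {h} → (Fin h → ℤ) → Pred ℤ 0ℓ → ℤ → Set
RepFunOne a A n =
  (∃ λ x → IsRep a A n x) ×
  (∀ x y → IsRep a A n x → IsRep a A n y → RepEquiv a x y)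

UniqueRepBasis : ∀ {h} → (Fin h → ℤ) → Pred ℤ 0ℓ → Set
UniqueRepBasis a A = ∀ n → RepFunOne a A n

gcdAll : ∀ {h} → (Fin h → ℤ) → ℕ
gcdAll {zero} a = 0
gcdAll {suc h} a = NG.gcd ∣ a zero ∣ (gcdAll (λ i → a (suc i)))

Primitive : ∀ {h} → (Fin h → ℤ) → Set
Primitive a = gcdAll a ≡ 1

SameSign : ∀ {h} → (Fin h → ℤ) → Set
SameSign a = (∀ i → 0ℤ < a i) ⊎ (∀ i → a i < 0ℤ)

{-# OPTIONS --safe #-}
module Submission where

-- The basis is the union of an increasing sequence of finite sets A, in each of which representations are
-- unique up to equivalence. To represent a further integer n, adjoin x₁, …, x_h with L(x) = n of the form
-- x = n u + T v, where L(u) = 1, v is a generic vector of the kernel of L, and T is large. A representation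
-- in the larger set is a formal one, whose entries are unknowns xᵢ or elements of A. Let y and z be two of
-- them with the same value, and let d be the difference of the total coefficients of the unknowns. Since T
-- is large, d·v = 0, and since v is generic, d = c a with an integer c. Then
--   L(z(x′)) − L(y(x′)) = c (n − L(x′))
-- for every substitution x′ for the unknowns. If c = 0, substituting an element of A reduces the equivalence
-- of y and z to uniqueness in A. If c = 1, substituting a solution of x′ = y(x′) in A represents n in A. If
-- c ≥ 2, then d is so large that y and z consist of unknowns only, and a constant x′ represents n in A.
-- When the coefficients have both signs, v can be chosen positive, so the xᵢ can be taken arbitrarily large.

open import Defs
open import Data.Nat using (ℕ; zero; suc; _≤_; z≤n; s≤s)
import Data.Nat as ℕ
import Data.Nat.Properties as ℕ
open import Data.Nat.Divisibility using (_∣0; ∣1⇒≡1)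
open import Data.Nat.GCD using (gcd; gcd[m,n]∣m; gcd[m,n]∣n; gcd-GCD; module Bézout)
open import Data.Integer using (ℤ; +_; -[1+_]; 0ℤ; 1ℤ; -1ℤ; _+_; _*_; -_; _-_; _^_; ∣_∣; NonZero; ≢-nonZero; _<_; -<+; -≤+; +<+; +≤+) renaming (_≤_ to _≤ℤ_)
open import Data.Integer.Properties as ℤ using (_≟_)
open import Data.Integer.Divisibility.Signed using (_∣_; ∣m∣n⇒∣m+n; ∣m⇒∣m*n; ∣-trans; ∣⇒∣ᵤ; ∣ᵤ⇒∣)
open import Data.Integer.Tactic.RingSolver using (solve-∀)
open import Data.Fin using (Fin; zero; suc; toℕ)
open import Data.Fin.Properties using (¬∀⟶∃¬)
open import Data.List using (List; []; _∷_; _++_; tabulate)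
open import Data.List.Membership.Propositional using (_∈_; find; lose)
open import Data.List.Membership.Propositional.Properties using (∈-++⁺ˡ; ∈-++⁺ʳ; ∈-++⁻; ∈-tabulate⁺; ∈-tabulate⁻)
open import Data.List.Relation.Binary.Subset.Propositional using (_⊆_)
open import Data.List.Relation.Unary.Any using (Any; here; there; any?)
import Data.Vec.Functional as Vector
open import Data.Product using (∃; ∃₂; _×_; _,_; proj₁; proj₂)
open import Data.Sum using (_⊎_; inj₁; inj₂; [_,_]′)
open import Data.Empty using (⊥)
open import Data.Unit using (tt)
open import Function using (_∘_; const; id)
open import Function.Bundles using (_⇔_; mk⇔)
open import Level using (0ℓ)
open import Relation.Nullary using (¬_; Dec; yes; no; contradiction)
open import Relation.Nullary.Decidable using (map′)
open import Relation.Unary using (Pred; U)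
open import Relation.Binary.PropositionalEquality using (_≡_; _≢_; refl; sym; trans; cong; cong₂; subst; module ≡-Reasoning)

-- Linear forms

norm : ∀ {h} → (Fin h → ℤ) → ℕ
norm {zero}  a = 0
norm {suc h} a = ∣ a zero ∣ ℕ.+ norm (a ∘ suc)

sumFin-cong : ∀ {h} {f g : Fin h → ℤ} → (∀ i → f i ≡ g i) → sumFin f ≡ sumFin g
sumFin-cong {zero}  eq = refl
sumFin-cong {suc h} eq = cong₂ _+_ (eq zero) (sumFin-cong (eq ∘ suc))

linForm-congˡ : ∀ {h} {a b : Fin h → ℤ} x → (∀ i → a i ≡ b i) → linForm a x ≡ linForm b x
linForm-congˡ x eq = sumFin-cong λ i → cong (_* x i) (eq i)

linForm-congʳ : ∀ {h} (a : Fin h → ℤ) {x y} → (∀ i → x i ≡ y i) → linForm a x ≡ linForm a y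
linForm-congʳ a eq = sumFin-cong λ i → cong (a i *_) (eq i)

linForm-comm : ∀ {h} (a x : Fin h → ℤ) → linForm a x ≡ linForm x a
linForm-comm a x = sumFin-cong λ i → ℤ.*-comm (a i) (x i)

linForm-zeroʳ : ∀ {h} (a : Fin h → ℤ) {x} → (∀ i → x i ≡ 0ℤ) → linForm a x ≡ 0ℤ
linForm-zeroʳ {zero}  a x≡0 = refl
linForm-zeroʳ {suc h} a x≡0 = cong₂ _+_
  (trans (cong (a zero *_) (x≡0 zero)) (ℤ.*-zeroʳ (a zero)))
  (linForm-zeroʳ (a ∘ suc) (x≡0 ∘ suc))

linForm-+ʳ : ∀ {h} (a x y : Fin h → ℤ) →
  linForm a (λ i → x i + y i) ≡ linForm a x + linForm a y
linForm-+ʳ {zero}  a x y = refl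
linForm-+ʳ {suc h} a x y = trans
  (cong (λ t → a zero * (x zero + y zero) + t) (linForm-+ʳ (a ∘ suc) (x ∘ suc) (y ∘ suc)))
  (rearrange (a zero) (x zero) (y zero) _ _)
  where
  rearrange : ∀ p q r s t → p * (q + r) + (s + t) ≡ (p * q + s) + (p * r + t)
  rearrange = solve-∀

linForm-*ʳ : ∀ {h} (a : Fin h → ℤ) c x → linForm a (λ i → c * x i) ≡ c * linForm a x
linForm-*ʳ {zero}  a c x = sym (ℤ.*-zeroʳ c)
linForm-*ʳ {suc h} a c x = trans
  (cong (λ t → a zero * (c * x zero) + t) (linForm-*ʳ (a ∘ suc) c (x ∘ suc)))
  (rearrange (a zero) c (x zero) _)
  where
  rearrange : ∀ p q r s → p * (q * r) + q * s ≡ q * (p * r + s)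
  rearrange = solve-∀

linForm--ʳ : ∀ {h} (a x y : Fin h → ℤ) →
  linForm a (λ i → x i - y i) ≡ linForm a x - linForm a y
linForm--ʳ {zero}  a x y = refl
linForm--ʳ {suc h} a x y = trans
  (cong (λ t → a zero * (x zero - y zero) + t) (linForm--ʳ (a ∘ suc) (x ∘ suc) (y ∘ suc)))
  (rearrange (a zero) (x zero) (y zero) _ _)
  where
  rearrange : ∀ p q r s t → p * (q - r) + (s - t) ≡ (p * q + s) - (p * r + t)
  rearrange = solve-∀

linForm-+ˡ : ∀ {h} (a b x : Fin h → ℤ) →
  linForm (λ i → a i + b i) x ≡ linForm a x + linForm b x
linForm-+ˡ a b x = begin
  linForm (λ i → a i + b i) x  ≡⟨ linForm-comm _ x ⟩
  linForm x (λ i → a i + b i)  ≡⟨ linForm-+ʳ x a b ⟩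
  linForm x a + linForm x b    ≡⟨ cong₂ _+_ (linForm-comm x a) (linForm-comm x b) ⟩
  linForm a x + linForm b x    ∎
  where open ≡-Reasoning

linForm--ˡ : ∀ {h} (a b x : Fin h → ℤ) →
  linForm (λ i → a i - b i) x ≡ linForm a x - linForm b x
linForm--ˡ a b x = begin
  linForm (λ i → a i - b i) x  ≡⟨ linForm-comm _ x ⟩
  linForm x (λ i → a i - b i)  ≡⟨ linForm--ʳ x a b ⟩
  linForm x a - linForm x b    ≡⟨ cong₂ _-_ (linForm-comm x a) (linForm-comm x b) ⟩
  linForm a x - linForm b x    ∎
  where open ≡-Reasoning

linForm-*ˡ : ∀ {h} c (a x : Fin h → ℤ) → linForm (λ i → c * a i) x ≡ c * linForm a x
linForm-*ˡ c a x = begin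
  linForm (λ i → c * a i) x  ≡⟨ linForm-comm _ x ⟩
  linForm x (λ i → c * a i)  ≡⟨ linForm-*ʳ x c a ⟩
  c * linForm x a            ≡⟨ cong (c *_) (linForm-comm x a) ⟩
  c * linForm a x            ∎
  where open ≡-Reasoning

∣linForm∣≤ : ∀ {h} (a x : Fin h → ℤ) {R} → (∀ i → ∣ x i ∣ ≤ R) → ∣ linForm a x ∣ ≤ norm a ℕ.* R
∣linForm∣≤ {zero}  a x     x≤R = z≤n
∣linForm∣≤ {suc h} a x {R} x≤R = begin
  ∣ a zero * x zero + rest ∣                   ≤⟨ ℤ.∣i+j∣≤∣i∣+∣j∣ (a zero * x zero) rest ⟩
  ∣ a zero * x zero ∣ ℕ.+ ∣ rest ∣              ≡⟨ cong (ℕ._+ ∣ rest ∣) (ℤ.abs-* (a zero) (x zero)) ⟩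
  ∣ a zero ∣ ℕ.* ∣ x zero ∣ ℕ.+ ∣ rest ∣
    ≤⟨ ℕ.+-mono-≤ (ℕ.*-monoʳ-≤ ∣ a zero ∣ (x≤R zero)) (∣linForm∣≤ (a ∘ suc) (x ∘ suc) (x≤R ∘ suc)) ⟩
  ∣ a zero ∣ ℕ.* R ℕ.+ norm (a ∘ suc) ℕ.* R    ≡⟨ ℕ.*-distribʳ-+ R ∣ a zero ∣ _ ⟨
  norm a ℕ.* R                                ∎
  where
  open ℕ.≤-Reasoning
  rest = linForm (a ∘ suc) (x ∘ suc)

∣linForm∣≤norm : ∀ {h} (a x : Fin h → ℤ) → (∀ i → ∣ x i ∣ ≤ 1) → ∣ linForm a x ∣ ≤ norm a
∣linForm∣≤norm a x x≤1 = subst (∣ linForm a x ∣ ≤_) (ℕ.*-identityʳ (norm a)) (∣linForm∣≤ a x x≤1)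

∣aᵢ∣≤norm : ∀ {h} (a : Fin h → ℤ) i → ∣ a i ∣ ≤ norm a
∣aᵢ∣≤norm a zero    = ℕ.m≤m+n ∣ a zero ∣ _
∣aᵢ∣≤norm a (suc i) = ℕ.≤-trans (∣aᵢ∣≤norm (a ∘ suc) i) (ℕ.m≤n+m _ ∣ a zero ∣)

-- The vanishing entry `x j` costs at least `∣ a j ∣ > 0` in the bound. This strictness later shows
-- that a formal representation of full mass contains no constants.
∣linForm∣<norm : ∀ {h} (a x : Fin h → ℤ) → (∀ i → a i ≢ 0ℤ) → (∀ i → ∣ x i ∣ ≤ 1) →
  ∀ j → x j ≡ 0ℤ → ∣ linForm a x ∣ ℕ.< norm a
∣linForm∣<norm a x a≢0 x≤1 zero x₀≡0 = begin-strict
  ∣ a zero * x zero + rest ∣   ≡⟨ cong (λ t → ∣ a zero * t + rest ∣) x₀≡0 ⟩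
  ∣ a zero * 0ℤ + rest ∣       ≡⟨ cong (λ t → ∣ t + rest ∣) (ℤ.*-zeroʳ (a zero)) ⟩
  ∣ 0ℤ + rest ∣                ≡⟨ cong ∣_∣ (ℤ.+-identityˡ rest) ⟩
  ∣ rest ∣                     ≤⟨ ∣linForm∣≤norm (a ∘ suc) (x ∘ suc) (x≤1 ∘ suc) ⟩
  norm (a ∘ suc)               <⟨ ℕ.+-monoˡ-< (norm (a ∘ suc)) (ℕ.n≢0⇒n>0 (a≢0 zero ∘ ℤ.∣i∣≡0⇒i≡0)) ⟩
  norm a                       ∎
  where
  open ℕ.≤-Reasoning
  rest = linForm (a ∘ suc) (x ∘ suc)
∣linForm∣<norm a x a≢0 x≤1 (suc j) xⱼ≡0 = begin-strict
  ∣ a zero * x zero + rest ∣        ≤⟨ ℤ.∣i+j∣≤∣i∣+∣j∣ (a zero * x zero) rest ⟩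
  ∣ a zero * x zero ∣ ℕ.+ ∣ rest ∣   ≡⟨ cong (ℕ._+ ∣ rest ∣) (ℤ.abs-* (a zero) (x zero)) ⟩
  ∣ a zero ∣ ℕ.* ∣ x zero ∣ ℕ.+ ∣ rest ∣
    <⟨ ℕ.+-mono-≤-< (ℕ.*-monoʳ-≤ ∣ a zero ∣ (x≤1 zero))
                    (∣linForm∣<norm (a ∘ suc) (x ∘ suc) (a≢0 ∘ suc) (x≤1 ∘ suc) j xⱼ≡0) ⟩
  ∣ a zero ∣ ℕ.* 1 ℕ.+ norm (a ∘ suc) ≡⟨ cong (ℕ._+ norm (a ∘ suc)) (ℕ.*-identityʳ ∣ a zero ∣) ⟩
  norm a                            ∎
  where
  open ℕ.≤-Reasoning
  rest = linForm (a ∘ suc) (x ∘ suc)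

-- Primitive forms

gcdAll∣linForm : ∀ {h} (a x : Fin h → ℤ) → + gcdAll a ∣ linForm a x
gcdAll∣linForm {zero}  a x = ∣ᵤ⇒∣ (0 ∣0)
gcdAll∣linForm {suc h} a x = ∣m∣n⇒∣m+n
  (∣m⇒∣m*n {m = a zero} (x zero) (∣ᵤ⇒∣ (gcd[m,n]∣m ∣ a zero ∣ g)))
  (∣-trans (∣ᵤ⇒∣ (gcd[m,n]∣n ∣ a zero ∣ g)) (gcdAll∣linForm (a ∘ suc) (x ∘ suc)))
  where g = gcdAll (a ∘ suc)

represents-1⇒primitive : ∀ {h} (a x : Fin h → ℤ) → linForm a x ≡ 1ℤ → Primitive a
represents-1⇒primitive a x ax≡1 = ∣1⇒≡1 (∣⇒∣ᵤ (subst (+ gcdAll a ∣_) ax≡1 (gcdAll∣linForm a x)))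

-- The Bézout identity over ℕ keeps a product on each side to avoid subtraction; this carries that
-- shape over to ℤ.
pos-+* : ∀ p q r s t → p ℕ.+ q ℕ.* r ≡ s ℕ.* t → + p + + q * + r ≡ + s * + t
pos-+* p q r s t eq = begin
  + p + + q * + r    ≡⟨ cong (λ z → + p + z) (ℤ.pos-* q r) ⟨
  + (p ℕ.+ q ℕ.* r)  ≡⟨ cong +_ eq ⟩
  + (s ℕ.* t)        ≡⟨ ℤ.pos-* s t ⟩
  + s * + t          ∎
  where open ≡-Reasoning

bézout-ℤ : ∀ m n → ∃₂ λ s t → + gcd m n ≡ s * + m + t * + n
bézout-ℤ m n with Bézout.identity (gcd-GCD m n)
... | Bézout.+- x y eq = + x , - + y , (begin
  + gcd m n                             ≡⟨ add-sub (+ gcd m n) (+ y) (+ n) ⟩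
  (+ gcd m n + + y * + n) - + y * + n   ≡⟨ cong (_- + y * + n) (pos-+* (gcd m n) y n x m eq) ⟩
  + x * + m - + y * + n                 ≡⟨ regroup (+ x * + m) (+ y) (+ n) ⟩
  + x * + m + - + y * + n               ∎)
  where
  open ≡-Reasoning
  add-sub : ∀ p q r → p ≡ (p + q * r) - q * r
  add-sub = solve-∀
  regroup : ∀ p q r → p - q * r ≡ p + - q * r
  regroup = solve-∀
... | Bézout.-+ x y eq = - + x , + y , (begin
  + gcd m n                             ≡⟨ add-sub (+ gcd m n) (+ x) (+ m) ⟩
  - + x * + m + (+ gcd m n + + x * + m) ≡⟨ cong (λ z → - + x * + m + z) (pos-+* (gcd m n) x m y n eq) ⟩
  - + x * + m + + y * + n               ∎)
  where
  open ≡-Reasoning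
  add-sub : ∀ p q r → p ≡ - q * r + (p + q * r)
  add-sub = solve-∀

sgn : ℤ → ℤ
sgn (+ zero)  = 0ℤ
sgn (+ suc _) = 1ℤ
sgn -[1+ _ ]  = -1ℤ

i*sgn-i≡∣i∣ : ∀ i → i * sgn i ≡ + ∣ i ∣
i*sgn-i≡∣i∣ (+ zero)  = refl
i*sgn-i≡∣i∣ (+ suc n) = ℤ.*-identityʳ (+ suc n)
i*sgn-i≡∣i∣ -[1+ n ]  = cong (+_ ∘ suc) (ℕ.*-identityʳ n)

∣sgn∣≤1 : ∀ i → ∣ sgn i ∣ ≤ 1
∣sgn∣≤1 (+ zero)  = z≤n
∣sgn∣≤1 (+ suc _) = s≤s z≤n
∣sgn∣≤1 -[1+ _ ]  = s≤s z≤n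

-- The sign vector attains the bound of `∣linForm∣≤norm`, so pairing with it recovers the ℓ¹ norm of
-- `a`.
linForm-sgn : ∀ {h} (a : Fin h → ℤ) → linForm a (sgn ∘ a) ≡ + norm a
linForm-sgn {zero}  a = refl
linForm-sgn {suc h} a = cong₂ _+_ (i*sgn-i≡∣i∣ (a zero)) (linForm-sgn (a ∘ suc))

linForm-bézout : ∀ {h} (a : Fin h → ℤ) → ∃ λ u → linForm a u ≡ + gcdAll a
linForm-bézout {zero}  a = (λ ()) , refl
linForm-bézout {suc h} a = u , (begin
  a zero * (s * sgn (a zero)) + linForm (a ∘ suc) (λ i → t * u′ i)
    ≡⟨ cong₂ _+_ (swap (a zero) s (sgn (a zero))) (linForm-*ʳ (a ∘ suc) t u′) ⟩
  s * (a zero * sgn (a zero)) + t * linForm (a ∘ suc) u′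
    ≡⟨ cong₂ (λ p q → s * p + t * q) (i*sgn-i≡∣i∣ (a zero)) au′ ⟩
  s * + ∣ a zero ∣ + t * + gcdAll (a ∘ suc)
    ≡⟨ eq ⟨
  + gcdAll a ∎)
  where
  open ≡-Reasoning
  ih  = linForm-bézout (a ∘ suc)
  u′  = proj₁ ih
  au′ = proj₂ ih
  bz  = bézout-ℤ ∣ a zero ∣ (gcdAll (a ∘ suc))
  s   = proj₁ bz
  t   = proj₁ (proj₂ bz)
  eq  = proj₂ (proj₂ bz)
  u : Fin (suc h) → ℤ
  -- Bézout is applied to `∣ a zero ∣`; the factor `sgn (a zero)` restores the sign.
  u zero    = s * sgn (a zero)
  u (suc i) = t * u′ i
  swap : ∀ p q r → p * (q * r) ≡ q * (p * r)
  swap = solve-∀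

-- Kernel vectors

-- For `v` in the kernel, every multiple of `a` pairs to zero with `v`; genericity excludes all
-- other vectors `d` of size at most `C` and makes the ratio an integer.
Generic : ∀ {h} → (Fin h → ℤ) → ℕ → (Fin h → ℤ) → Set
Generic a C v = ∀ d → (∀ i → ∣ d i ∣ ≤ C) → linForm d v ≡ 0ℤ → ∃ λ c → ∀ i → d i ≡ c * a i

-- A nonzero multiple of `Q` has absolute value at least `Q`. This separation of scales is used for
-- base-`Q` digits, for making a kernel vector positive, and for the large parameter `T`.
remainder-zero : ∀ Q q p → ∣ q ∣ ℕ.< Q → q + + Q * p ≡ 0ℤ → q ≡ 0ℤ × p ≡ 0ℤ
remainder-zero Q q p ∣q∣<Q eq with p ≟ 0ℤ
... | yes p≡0 = trans (sym (ℤ.+-identityʳ q)) (subst (λ t → q + t ≡ 0ℤ) Qp≡0 eq) , p≡0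
  where
  Qp≡0 : + Q * p ≡ 0ℤ
  Qp≡0 = trans (cong (+ Q *_) p≡0) (ℤ.*-zeroʳ (+ Q))
... | no p≢0 = contradiction ∣q∣<Q (ℕ.≤⇒≯ (begin
  Q                      ≡⟨ ℕ.*-identityʳ Q ⟨
  Q ℕ.* 1                ≤⟨ ℕ.*-monoʳ-≤ Q (ℕ.n≢0⇒n>0 (p≢0 ∘ ℤ.∣i∣≡0⇒i≡0)) ⟩
  Q ℕ.* ∣ p ∣            ≡⟨ ℤ.abs-* (+ Q) p ⟨
  ∣ + Q * p ∣            ≡⟨ cong ∣_∣ (isolate q (+ Q * p)) ⟩
  ∣ (q + + Q * p) - q ∣  ≡⟨ cong (λ t → ∣ t - q ∣) eq ⟩
  ∣ 0ℤ - q ∣             ≡⟨ cong ∣_∣ (ℤ.+-identityˡ (- q)) ⟩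
  ∣ - q ∣                ≡⟨ ℤ.∣-i∣≡∣i∣ q ⟩
  ∣ q ∣                  ∎))
  where
  open ℕ.≤-Reasoning
  isolate : ∀ x y → y ≡ (x + y) - x
  isolate = solve-∀

-- The lowest digit is the remainder modulo `Q`, hence zero; dividing the sum by `Q` leaves the same
-- problem for the remaining digits.
digits-zero : ∀ {k} Q (δ : Fin k → ℤ) → (∀ i → ∣ δ i ∣ ℕ.< Q) →
  linForm δ (λ i → (+ Q) ^ toℕ i) ≡ 0ℤ → ∀ i → δ i ≡ 0ℤ
digits-zero {suc k} Q δ δ<Q eq = digit
  where
  rest = linForm (δ ∘ suc) (λ i → (+ Q) ^ toℕ i)
  split : δ zero ≡ 0ℤ × rest ≡ 0ℤ
  split = remainder-zero Q (δ zero) rest (δ<Q zero) (trans (sym (cong₂ _+_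
    (ℤ.*-identityʳ (δ zero)) (linForm-*ʳ (δ ∘ suc) (+ Q) (λ i → (+ Q) ^ toℕ i)))) eq)
  digit : ∀ i → δ i ≡ 0ℤ
  digit zero    = proj₁ split
  digit (suc i) = digits-zero Q (δ ∘ suc) (δ<Q ∘ suc) (proj₂ split) i

-- The vanishing minors make `d` the rational multiple `d zero / a zero` of `a`. Pairing with `u`,
-- where the form takes the value 1, identifies this ratio with the integer `linForm d u`.
proportional : ∀ {k} (a d u : Fin (suc k) → ℤ) → a zero ≢ 0ℤ → linForm a u ≡ 1ℤ →
  (∀ i → a zero * d i ≡ d zero * a i) → ∀ i → d i ≡ linForm d u * a i
proportional a d u a₀≢0 au≡1 minors i = ℤ.*-cancelˡ-≡ (a zero) _ _ (begin
  a zero * d i                  ≡⟨ minors i ⟩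
  d zero * a i                  ≡⟨ cong (_* a i) d₀≡ ⟩
  a zero * linForm d u * a i    ≡⟨ ℤ.*-assoc (a zero) (linForm d u) (a i) ⟩
  a zero * (linForm d u * a i)  ∎)
  where
  open ≡-Reasoning
  instance
    a₀-nonZero : NonZero (a zero)
    a₀-nonZero = ≢-nonZero a₀≢0
  d₀≡ : d zero ≡ a zero * linForm d u
  d₀≡ = begin
    d zero                           ≡⟨ ℤ.*-identityʳ (d zero) ⟨
    d zero * 1ℤ                      ≡⟨ cong (d zero *_) au≡1 ⟨
    d zero * linForm a u             ≡⟨ linForm-*ˡ (d zero) a u ⟨
    linForm (λ j → d zero * a j) u   ≡⟨ linForm-congˡ u minors ⟨
    linForm (λ j → a zero * d j) u   ≡⟨ linForm-*ˡ (a zero) d u ⟩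
    a zero * linForm d u             ∎

-- The kernel vector Σᵢ Qⁱ (a₀ eᵢ₊₁ − aᵢ₊₁ e₀) pairs with d to Σᵢ Qⁱ (a₀ dᵢ₊₁ − aᵢ₊₁ d₀);
-- for Q large this is a base-Q expansion, so it vanishes only if all the minors do.
generic-kernel : ∀ {h} (a : Fin h → ℤ) → (∀ i → a i ≢ 0ℤ) → ∀ u → linForm a u ≡ 1ℤ →
  ∀ C → ∃ λ v → linForm a v ≡ 0ℤ × Generic a C v
generic-kernel {zero}  a a≢0 u ()
generic-kernel {suc k} a a≢0 u au≡1 C = v , av≡0 , generic
  where
  -- Each minor `a₀ dᵢ₊₁ − d₀ aᵢ₊₁` has absolute value at most `norm a ℕ.* C`, so it is an
  -- admissible digit.
  Q = suc (norm a ℕ.* C)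
  B : Fin k → ℤ
  B i = (+ Q) ^ toℕ i
  v : Fin (suc k) → ℤ
  v zero    = - linForm (a ∘ suc) B
  v (suc i) = a zero * B i

  δ : (Fin (suc k) → ℤ) → Fin k → ℤ
  δ d i = a zero * d (suc i) - d zero * a (suc i)

  dv≡δB : ∀ d → linForm d v ≡ linForm (δ d) B
  dv≡δB d = begin
    d zero * - linForm (a ∘ suc) B + linForm (d ∘ suc) (λ i → a zero * B i)
      ≡⟨ cong (λ t → d zero * - linForm (a ∘ suc) B + t) (linForm-*ʳ (d ∘ suc) (a zero) B) ⟩
    d zero * - linForm (a ∘ suc) B + a zero * linForm (d ∘ suc) B
      ≡⟨ rearrange (d zero) _ (a zero) _ ⟩
    a zero * linForm (d ∘ suc) B - d zero * linForm (a ∘ suc) B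
      ≡⟨ cong₂ _-_ (linForm-*ˡ (a zero) (d ∘ suc) B) (linForm-*ˡ (d zero) (a ∘ suc) B) ⟨
    linForm (λ i → a zero * d (suc i)) B - linForm (λ i → d zero * a (suc i)) B
      ≡⟨ linForm--ˡ (λ i → a zero * d (suc i)) (λ i → d zero * a (suc i)) B ⟨
    linForm (δ d) B ∎
    where
    open ≡-Reasoning
    rearrange : ∀ p q r s → p * - q + r * s ≡ r * s - p * q
    rearrange = solve-∀

  av≡0 : linForm a v ≡ 0ℤ
  av≡0 = begin
    linForm a v      ≡⟨ dv≡δB a ⟩
    linForm (δ a) B  ≡⟨ linForm-comm (δ a) B ⟩
    linForm B (δ a)  ≡⟨ linForm-zeroʳ B (λ i → ℤ.+-inverseʳ (a zero * a (suc i))) ⟩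
    0ℤ               ∎
    where open ≡-Reasoning

  δ<Q : ∀ d → (∀ i → ∣ d i ∣ ≤ C) → ∀ i → ∣ δ d i ∣ ℕ.< Q
  δ<Q d d≤C i = s≤s (begin
    ∣ δ d i ∣
      ≤⟨ ℤ.∣i-j∣≤∣i∣+∣j∣ (a zero * d (suc i)) (d zero * a (suc i)) ⟩
    ∣ a zero * d (suc i) ∣ ℕ.+ ∣ d zero * a (suc i) ∣
      ≡⟨ cong₂ ℕ._+_ (ℤ.abs-* (a zero) (d (suc i)))
              (trans (ℤ.abs-* (d zero) (a (suc i))) (ℕ.*-comm ∣ d zero ∣ _)) ⟩
    ∣ a zero ∣ ℕ.* ∣ d (suc i) ∣ ℕ.+ ∣ a (suc i) ∣ ℕ.* ∣ d zero ∣
      ≤⟨ ℕ.+-mono-≤ (ℕ.*-monoʳ-≤ ∣ a zero ∣ (d≤C (suc i)))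
                       (ℕ.*-mono-≤ (∣aᵢ∣≤norm (a ∘ suc) i) (d≤C zero)) ⟩
    ∣ a zero ∣ ℕ.* C ℕ.+ norm (a ∘ suc) ℕ.* C
      ≡⟨ ℕ.*-distribʳ-+ C ∣ a zero ∣ _ ⟨
    norm a ℕ.* C ∎)
    where open ℕ.≤-Reasoning

  generic : Generic a C v
  generic d d≤C dv≡0 = linForm d u , proportional a d u (a≢0 zero) au≡1 minors
    where
    δ≡0 : ∀ i → δ d i ≡ 0ℤ
    δ≡0 = digits-zero Q (δ d) (δ<Q d d≤C) (trans (sym (dv≡δB d)) dv≡0)
    minors : ∀ i → a zero * d i ≡ d zero * a i
    minors zero    = ℤ.*-comm (a zero) (d zero)
    minors (suc i) = ℤ.i-j≡0⇒i≡j _ _ (δ≡0 i)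

-- Positive kernel vectors for coefficients of mixed sign

i≤+∣i∣ : ∀ i → i ≤ℤ + ∣ i ∣
i≤+∣i∣ (+ n)    = ℤ.≤-refl
i≤+∣i∣ -[1+ n ] = -≤+

n≤n*i : ∀ n {i} → 1ℤ ≤ℤ i → + n ≤ℤ + n * i
n≤n*i n {i} 1≤i = subst (_≤ℤ + n * i) (ℤ.*-identityʳ (+ n)) (ℤ.*-monoˡ-≤-nonNeg (+ n) 1≤i)

-- A large multiple of the positive vector `w` is added to `v`. Genericity survives because `K`
-- exceeds every `∣ linForm d v ∣` in question, so a vanishing sum forces `linForm d v` to vanish.
generic-positive-kernel : ∀ {h} (a v w : Fin h → ℤ) {C} →
  linForm a v ≡ 0ℤ → Generic a C v → linForm a w ≡ 0ℤ → (∀ i → 1ℤ ≤ℤ w i) →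
  ∃ λ v′ → linForm a v′ ≡ 0ℤ × Generic a C v′ × (∀ i → 1ℤ ≤ℤ v′ i)
generic-positive-kernel a v w {C} av≡0 generic aw≡0 w≥1 = v′ , av′≡0 , generic′ , v′≥1
  where
  -- The factor is `suc C` because `K` must exceed both `norm v ℕ.* C` and each `∣ v i ∣`, even for
  -- `C = 0`.
  K = suc (norm v ℕ.* suc C)
  v′ : _ → ℤ
  v′ i = v i + + K * w i
  dv′ : ∀ d → linForm d v′ ≡ linForm d v + + K * linForm d w
  dv′ d = trans (linForm-+ʳ d v (λ i → + K * w i)) (cong (λ t → linForm d v + t) (linForm-*ʳ d (+ K) w))
  av′≡0 : linForm a v′ ≡ 0ℤ
  av′≡0 = trans (dv′ a) (cong₂ _+_ av≡0 (trans (cong (+ K *_) aw≡0) (ℤ.*-zeroʳ (+ K))))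
  generic′ : Generic a C v′
  generic′ d d≤C dv′≡0 = generic d d≤C
    (proj₁ (remainder-zero K (linForm d v) (linForm d w) dv<K (trans (sym (dv′ d)) dv′≡0)))
    where
    open ℕ.≤-Reasoning
    dv<K : ∣ linForm d v ∣ ℕ.< K
    dv<K = s≤s (begin
      ∣ linForm d v ∣    ≡⟨ cong ∣_∣ (linForm-comm d v) ⟩
      ∣ linForm v d ∣    ≤⟨ ∣linForm∣≤ v d d≤C ⟩
      norm v ℕ.* C       ≤⟨ ℕ.*-monoʳ-≤ (norm v) (ℕ.n≤1+n C) ⟩
      norm v ℕ.* suc C   ∎)
  v′≥1 : ∀ i → 1ℤ ≤ℤ v′ i
  v′≥1 i = begin
    1ℤ                              ≡⟨ cancel 1ℤ (v i) ⟩
    v i + (1ℤ + - v i)              ≤⟨ ℤ.+-monoʳ-≤ (v i) (ℤ.+-monoʳ-≤ 1ℤ (i≤+∣i∣ (- v i))) ⟩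
    v i + + suc ∣ - v i ∣           ≡⟨ cong (λ t → v i + + suc t) (ℤ.∣-i∣≡∣i∣ (v i)) ⟩
    v i + + suc ∣ v i ∣             ≤⟨ ℤ.+-monoʳ-≤ (v i) (+≤+ (s≤s (ℕ.≤-trans (∣aᵢ∣≤norm v i) (ℕ.m≤m*n (norm v) (suc C))))) ⟩
    v i + + K                       ≤⟨ ℤ.+-monoʳ-≤ (v i) (n≤n*i K (w≥1 i)) ⟩
    v i + + K * w i                 ∎
    where
    open ℤ.≤-Reasoning
    cancel : ∀ p q → p ≡ q + (p + - q)
    cancel = solve-∀

0≤sumFin : ∀ {h} (f : Fin h → ℤ) → (∀ i → 0ℤ ≤ℤ f i) → 0ℤ ≤ℤ sumFin f
0≤sumFin {zero}  f f≥0 = ℤ.≤-refl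
0≤sumFin {suc h} f f≥0 = ℤ.+-mono-≤ (f≥0 zero) (0≤sumFin (f ∘ suc) (f≥0 ∘ suc))

1≤sumFin : ∀ {h} (f : Fin h → ℤ) → (∀ i → 0ℤ ≤ℤ f i) → ∀ j → 1ℤ ≤ℤ f j → 1ℤ ≤ℤ sumFin f
1≤sumFin f f≥0 zero    1≤f = ℤ.+-mono-≤ 1≤f (0≤sumFin (f ∘ suc) (f≥0 ∘ suc))
1≤sumFin f f≥0 (suc j) 1≤f = ℤ.+-mono-≤ (f≥0 zero) (1≤sumFin (f ∘ suc) (f≥0 ∘ suc) j 1≤f)

oppositeSign : ∀ {h} (a : Fin h → ℤ) → (∀ i → a i ≢ 0ℤ) → ¬ SameSign a →
  ∀ i → ∃ λ j → sgn (a j) ≡ - sgn (a i)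
oppositeSign a a≢0 mixed i with a i in aᵢ≡
... | + zero  = contradiction aᵢ≡ (a≢0 i)
... | + suc _ with ¬∀⟶∃¬ _ _ (λ j → 0ℤ ℤ.<? a j) (mixed ∘ inj₁)
...   | j , aⱼ≯0 = j , negative (a j) aⱼ≯0 (a≢0 j)
  where
  negative : ∀ x → ¬ (0ℤ < x) → x ≢ 0ℤ → sgn x ≡ -1ℤ
  negative (+ zero)  _   x≢0 = contradiction refl x≢0
  negative (+ suc _) x≯0 _   = contradiction (+<+ (s≤s z≤n)) x≯0
  negative -[1+ _ ]  _   _   = refl
oppositeSign a a≢0 mixed i | -[1+ _ ] with ¬∀⟶∃¬ _ _ (λ j → a j ℤ.<? 0ℤ) (mixed ∘ inj₂)
...   | j , aⱼ≮0 = j , positive (a j) aⱼ≮0 (a≢0 j)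
  where
  positive : ∀ x → ¬ (x < 0ℤ) → x ≢ 0ℤ → sgn x ≡ 1ℤ
  positive (+ zero)  _   x≢0 = contradiction refl x≢0
  positive (+ suc _) _   _   = refl
  positive -[1+ _ ]  x≮0 _   = contradiction -<+ x≮0

-- The form takes the value `s` at the constant vector 1 and `norm a` at `sgn ∘ a`, so the
-- combination with these two weights crossed lies in the kernel.
positive-kernel : ∀ {h} (a : Fin h → ℤ) → (∀ i → a i ≢ 0ℤ) → ¬ SameSign a →
  ∃ λ w → linForm a w ≡ 0ℤ × (∀ i → 1ℤ ≤ℤ w i)
positive-kernel {h} a a≢0 mixed = w , aw≡0 , w≥1
  where
  s = linForm a (const 1ℤ)
  -- wᵢ = Σⱼ aⱼ (sgn aⱼ − sgn aᵢ), whose terms are nonnegative and do not all vanish when the signs are mixed.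
  w : Fin h → ℤ
  w i = + norm a * 1ℤ - s * sgn (a i)

  aw≡0 : linForm a w ≡ 0ℤ
  aw≡0 = begin
    linForm a w
      ≡⟨ linForm--ʳ a (λ _ → + norm a * 1ℤ) (λ i → s * sgn (a i)) ⟩
    linForm a (λ _ → + norm a * 1ℤ) - linForm a (λ i → s * sgn (a i))
      ≡⟨ cong₂ _-_ (linForm-*ʳ a (+ norm a) (const 1ℤ)) (linForm-*ʳ a s (sgn ∘ a)) ⟩
    + norm a * s - s * linForm a (sgn ∘ a)
      ≡⟨ cong (λ t → + norm a * s - s * t) (linForm-sgn a) ⟩
    + norm a * s - s * + norm a
      ≡⟨ ℤ.i≡j⇒i-j≡0 (ℤ.*-comm (+ norm a) s) ⟩
    0ℤ ∎
    where open ≡-Reasoning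

  w≡ : ∀ i → w i ≡ linForm a (λ j → sgn (a j) - sgn (a i) * 1ℤ)
  w≡ i = begin
    + norm a * 1ℤ - s * sgn (a i)
      ≡⟨ cong₂ _-_ (ℤ.*-identityʳ (+ norm a)) (ℤ.*-comm s (sgn (a i))) ⟩
    + norm a - sgn (a i) * s
      ≡⟨ cong₂ _-_ (linForm-sgn a) (linForm-*ʳ a (sgn (a i)) (const 1ℤ)) ⟨
    linForm a (sgn ∘ a) - linForm a (λ _ → sgn (a i) * 1ℤ)
      ≡⟨ linForm--ʳ a (sgn ∘ a) (λ _ → sgn (a i) * 1ℤ) ⟨
    linForm a (λ j → sgn (a j) - sgn (a i) * 1ℤ) ∎
    where open ≡-Reasoning

  term≥0 : ∀ x y → 0ℤ ≤ℤ x * (sgn x - sgn y * 1ℤ)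
  term≥0 (+ zero)  y         = ℤ.≤-refl
  term≥0 (+ suc m) (+ zero)  = +≤+ z≤n
  term≥0 (+ suc m) (+ suc n) = ℤ.≤-reflexive (sym (ℤ.*-zeroʳ (+ suc m)))
  term≥0 (+ suc m) -[1+ n ]  = +≤+ z≤n
  term≥0 -[1+ m ]  (+ zero)  = +≤+ z≤n
  term≥0 -[1+ m ]  (+ suc n) = +≤+ z≤n
  term≥0 -[1+ m ]  -[1+ n ]  = ℤ.≤-reflexive (sym (ℤ.*-zeroʳ -[1+ m ]))

  term≥1 : ∀ x y → x ≢ 0ℤ → sgn x ≡ - sgn y → 1ℤ ≤ℤ x * (sgn x - sgn y * 1ℤ)
  term≥1 (+ zero)  y         x≢0 _ = contradiction refl x≢0
  term≥1 (+ suc m) (+ zero)  _ ()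
  term≥1 (+ suc m) (+ suc n) _ ()
  term≥1 (+ suc m) -[1+ n ]  _   _ = +≤+ (s≤s z≤n)
  term≥1 -[1+ m ]  (+ suc n) _   _ = +≤+ (s≤s z≤n)

  w≥1 : ∀ i → 1ℤ ≤ℤ w i
  w≥1 i = subst (1ℤ ≤ℤ_) (sym (w≡ i)) (1≤sumFin _ (λ j → term≥0 (a j) (a i)) j
            (term≥1 (a j) (a i) (a≢0 j) (proj₂ (oppositeSign a a≢0 mixed i))))
    where j = proj₁ (oppositeSign a a≢0 mixed i)

-- Formal representations

-- With this indicator, `weight a x ξ` becomes the value of the linear form at `ind ξ ∘ x`, so
-- weights obey the same linear identities as represented integers.
ind : ℤ → ℤ → ℤ
ind ξ c with c ≟ ξ
... | yes _ = 1ℤ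
... | no  _ = 0ℤ

-- The summand of weight is a local function without a name in scope, so unification has to supply it.
mutual
  weight≡ : ∀ {h} (a x : Fin h → ℤ) ξ → weight a x ξ ≡ linForm a (ind ξ ∘ x)
  weight≡ a x ξ = sumFin-cong (weight-summand a x ξ)

  weight-summand : ∀ {h} (a x : Fin h → ℤ) ξ i → _ ≡ a i * ind ξ (x i)
  weight-summand a x ξ i with x i ≟ ξ
  ... | yes _ = sym (ℤ.*-identityʳ (a i))
  ... | no  _ = sym (ℤ.*-zeroʳ (a i))

kronecker : ∀ {h} → Fin h → Fin h → ℤ
kronecker zero    zero    = 1ℤ
kronecker zero    (suc i) = 0ℤ
kronecker (suc k) zero    = 0ℤ
kronecker (suc k) (suc i) = kronecker k i

linForm-kronecker : ∀ {h} (k : Fin h) D → linForm (kronecker k) D ≡ D k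
linForm-kronecker {suc h} zero D = begin
  1ℤ * D zero + linForm {h} (const 0ℤ) (D ∘ suc)
    ≡⟨ cong₂ _+_ (ℤ.*-identityˡ (D zero)) (linForm-comm {h} (const 0ℤ) (D ∘ suc)) ⟩
  D zero + linForm (D ∘ suc) (const 0ℤ)
    ≡⟨ cong (λ t → D zero + t) (linForm-zeroʳ (D ∘ suc) λ _ → refl) ⟩
  D zero + 0ℤ
    ≡⟨ ℤ.+-identityʳ (D zero) ⟩
  D zero ∎
  where open ≡-Reasoning
linForm-kronecker (suc k) D = trans (ℤ.+-identityˡ _) (linForm-kronecker k (D ∘ suc))

∣kronecker∣≤1 : ∀ {h} (k i : Fin h) → ∣ kronecker k i ∣ ≤ 1
∣kronecker∣≤1 zero    zero    = s≤s z≤n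
∣kronecker∣≤1 zero    (suc i) = z≤n
∣kronecker∣≤1 (suc k) zero    = z≤n
∣kronecker∣≤1 (suc k) (suc i) = ∣kronecker∣≤1 k i

-- An entry of a formal representation is one of h unknowns or a constant from V.
module Formal {h : ℕ} {V : Set} (val : V → ℤ) where

  Entry : Set
  Entry = Fin h ⊎ V

  eval : (Fin h → ℤ) → Entry → ℤ
  eval x = [ x , val ]′

  unknownPart : (Fin h → ℤ) → Entry → ℤ
  unknownPart D = [ D , const 0ℤ ]′

  multiplicity : Entry → Fin h → ℤ
  multiplicity = [ kronecker , const (const 0ℤ) ]′

  coeff : ∀ {k} → (Fin k → ℤ) → (Fin k → Entry) → Fin h → ℤ
  coeff a y i = linForm a (λ j → multiplicity (y j) i)

  linForm-multiplicity : ∀ D e → linForm (multiplicity e) D ≡ unknownPart D e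
  linForm-multiplicity D (inj₁ k) = linForm-kronecker k D
  linForm-multiplicity D (inj₂ c) =
    trans (linForm-comm (const 0ℤ) D) (linForm-zeroʳ D λ _ → refl)

  -- Interchange of summation: collecting the coefficient of each unknown is the transpose of
  -- substituting for the unknowns.
  linForm-coeff : ∀ {k} (a : Fin k → ℤ) y D → linForm (coeff a y) D ≡ linForm a (unknownPart D ∘ y)
  linForm-coeff {zero}  a y D = trans (linForm-comm (const 0ℤ) D) (linForm-zeroʳ D λ _ → refl)
  linForm-coeff {suc k} a y D = begin
    linForm (coeff a y) D
      ≡⟨ linForm-+ˡ (λ i → a zero * multiplicity (y zero) i) (coeff (a ∘ suc) (y ∘ suc)) D ⟩
    linForm (λ i → a zero * multiplicity (y zero) i) D + linForm (coeff (a ∘ suc) (y ∘ suc)) D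
      ≡⟨ cong₂ _+_
           (trans (linForm-*ˡ (a zero) (multiplicity (y zero)) D)
                  (cong (a zero *_) (linForm-multiplicity D (y zero))))
           (linForm-coeff (a ∘ suc) (y ∘ suc) D) ⟩
    linForm a (unknownPart D ∘ y) ∎
    where open ≡-Reasoning

  ∣coeff∣≤norm : ∀ {k} (a : Fin k → ℤ) y i → ∣ coeff a y i ∣ ≤ norm a
  ∣coeff∣≤norm a y i = ∣linForm∣≤norm a _ (λ j → bound (y j))
    where
    bound : ∀ e → ∣ multiplicity e i ∣ ≤ 1
    bound (inj₁ k) = ∣kronecker∣≤1 k i
    bound (inj₂ c) = z≤n

  -- Constants cancel, so a change of substitution is seen through `coeff a y` alone. Taking `g` to
  -- be `id` treats represented integers, and `ind ξ` treats weights.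
  eval-difference : ∀ {k} (a : Fin k → ℤ) y (g : ℤ → ℤ) x x′ →
    linForm a (g ∘ eval x ∘ y) - linForm a (g ∘ eval x′ ∘ y) ≡
    linForm (coeff a y) (λ i → g (x i) - g (x′ i))
  eval-difference a y g x x′ = begin
    linForm a (g ∘ eval x ∘ y) - linForm a (g ∘ eval x′ ∘ y)
      ≡⟨ linForm--ʳ a (g ∘ eval x ∘ y) (g ∘ eval x′ ∘ y) ⟨
    linForm a (λ j → g (eval x (y j)) - g (eval x′ (y j)))
      ≡⟨ linForm-congʳ a (λ j → entrywise (y j)) ⟩
    linForm a (unknownPart (λ i → g (x i) - g (x′ i)) ∘ y)
      ≡⟨ linForm-coeff a y _ ⟨
    linForm (coeff a y) (λ i → g (x i) - g (x′ i)) ∎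
    where
    open ≡-Reasoning
    entrywise : ∀ e → g (eval x e) - g (eval x′ e) ≡ unknownPart (λ i → g (x i) - g (x′ i)) e
    entrywise (inj₁ k) = refl
    entrywise (inj₂ c) = ℤ.+-inverseʳ (g (val c))

-- Unknowns that depend on each other cyclically receive the default value.
solve-system : ∀ {m} {V : Set} → V → (y : Fin m → Fin m ⊎ V) →
  ∃ λ (x : Fin m → V) → ∀ i → [ x , id ]′ (y i) ≡ x i
solve-system {zero}  default y = (λ ()) , λ ()
solve-system {suc m} {V} default y = x , solves
  where
  pivot : Fin (suc m) ⊎ V → Fin m ⊎ V
  -- The right-hand side for unknown `zero` is freed of that unknown: a self-reference becomes the
  -- default. It then replaces the unknown in the remaining equations.
  pivot (inj₁ zero)    = inj₂ default
  pivot (inj₁ (suc j)) = inj₁ j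
  pivot (inj₂ c)       = inj₂ c

  eliminate : Fin (suc m) ⊎ V → Fin m ⊎ V
  eliminate (inj₁ zero)    = pivot (y zero)
  eliminate (inj₁ (suc j)) = inj₁ j
  eliminate (inj₂ c)       = inj₂ c

  reduced = solve-system default (eliminate ∘ y ∘ suc)
  x′ = proj₁ reduced

  x : Fin (suc m) → V
  x zero    = [ x′ , id ]′ (pivot (y zero))
  x (suc i) = x′ i

  eliminate-sound : ∀ e → [ x , id ]′ e ≡ [ x′ , id ]′ (eliminate e)
  eliminate-sound (inj₁ zero)    = refl
  eliminate-sound (inj₁ (suc j)) = refl
  eliminate-sound (inj₂ c)       = refl

  -- The entry `y zero` is generalized to `e` to allow a case split; under self-reference, `e≡` is
  -- what evaluates `x zero` to the default.
  pivot-sound : ∀ e → e ≡ y zero → [ x , id ]′ e ≡ [ x′ , id ]′ (pivot e)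
  pivot-sound (inj₁ zero)    e≡ = cong ([ x′ , id ]′ ∘ pivot) (sym e≡)
  pivot-sound (inj₁ (suc j)) e≡ = refl
  pivot-sound (inj₂ c)       e≡ = refl

  solves : ∀ i → [ x , id ]′ (y i) ≡ x i
  solves zero    = pivot-sound (y zero) refl
  solves (suc i) = trans (eliminate-sound (y (suc i))) (proj₂ reduced i)

all-inj₁⊎some-inj₂ : ∀ {k} {B C : Set} (y : Fin k → B ⊎ C) →
  (∃ λ (f : Fin k → B) → ∀ j → y j ≡ inj₁ (f j)) ⊎ (∃₂ λ j c → y j ≡ inj₂ c)
all-inj₁⊎some-inj₂ {zero}  y = inj₁ ((λ ()) , λ ())
all-inj₁⊎some-inj₂ {suc k} y with y zero in y₀≡ | all-inj₁⊎some-inj₂ (y ∘ suc)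
... | inj₂ c | _                   = inj₂ (zero , c , y₀≡)
... | inj₁ b | inj₂ (j , c , yⱼ≡)  = inj₂ (suc j , c , yⱼ≡)
... | inj₁ b | inj₁ (f , y≡)       = inj₁ (b Vector.∷ f , λ { zero → y₀≡ ; (suc j) → y≡ j })

-- Adjoining a representation

Unique : ∀ {h} → (Fin h → ℤ) → Pred ℤ 0ℓ → Set
Unique a A = ∀ n x y → IsRep a A n x → IsRep a A n y → RepEquiv a x y

-- Here `x` is any vector whose value is not yet represented. Its size and genericity enter only
-- through the hypothesis that coefficient differences are proportional to `a`.
module Adjoin {h} (a : Fin h → ℤ) (a≢0 : ∀ i → a i ≢ 0ℤ)
  (A : Pred ℤ 0ℓ) (α∈A : ∃ A) (unique : Unique a A)
  (x : Fin h → ℤ) (new : ∀ y → ¬ IsRep a A (linForm a x) y) where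

  open Formal {h} {∃ A} proj₁ public

  eval∈A : ∀ (x′ : Fin h → ∃ A) e → A (eval (proj₁ ∘ x′) e)
  eval∈A x′ (inj₁ k) = proj₂ (x′ k)
  eval∈A x′ (inj₂ c) = proj₂ c

  coeff-difference : ∀ (y z : Fin h → Entry) D →
    linForm (λ i → coeff a y i - coeff a z i) D ≡
    linForm a (unknownPart D ∘ y) - linForm a (unknownPart D ∘ z)
  coeff-difference y z D = trans (linForm--ˡ (coeff a y) (coeff a z) D)
    (cong₂ _-_ (linForm-coeff a y D) (linForm-coeff a z D))

  module _ (y z : Fin h → Entry) (y≡z : linForm a (eval x ∘ y) ≡ linForm a (eval x ∘ z))
           (c : ℤ) (d≡ca : ∀ i → coeff a y i - coeff a z i ≡ c * a i) where

    -- Although y and z agree only at x, proportionality of d to a controls them at every x′.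
    eval-relation : ∀ x′ → linForm a (eval x′ ∘ z) - linForm a (eval x′ ∘ y) ≡
                           c * (linForm a x - linForm a x′)
    eval-relation x′ = begin
      linForm a (eval x′ ∘ z) - linForm a (eval x′ ∘ y)
        ≡⟨ rearrange (linForm a (eval x ∘ y)) (linForm a (eval x′ ∘ z)) (linForm a (eval x′ ∘ y)) ⟩
      (linForm a (eval x ∘ y) - linForm a (eval x′ ∘ y)) - (linForm a (eval x ∘ y) - linForm a (eval x′ ∘ z))
        ≡⟨ cong (λ t → (linForm a (eval x ∘ y) - linForm a (eval x′ ∘ y)) - (t - linForm a (eval x′ ∘ z))) y≡z ⟩
      (linForm a (eval x ∘ y) - linForm a (eval x′ ∘ y)) - (linForm a (eval x ∘ z) - linForm a (eval x′ ∘ z))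
        ≡⟨ cong₂ _-_ (eval-difference a y id x x′) (eval-difference a z id x x′) ⟩
      linForm (coeff a y) D - linForm (coeff a z) D
        ≡⟨ linForm--ˡ (coeff a y) (coeff a z) D ⟨
      linForm (λ i → coeff a y i - coeff a z i) D
        ≡⟨ linForm-congˡ D d≡ca ⟩
      linForm (λ i → c * a i) D
        ≡⟨ linForm-*ˡ c a D ⟩
      c * linForm a D
        ≡⟨ cong (c *_) (linForm--ʳ a x x′) ⟩
      c * (linForm a x - linForm a x′) ∎
      where
      open ≡-Reasoning
      D = λ i → x i - x′ i
      rearrange : ∀ p q r → q - r ≡ (p - r) - (p - q)
      rearrange = solve-∀

  module _ (y z : Fin h → Entry) (y≡z : linForm a (eval x ∘ y) ≡ linForm a (eval x ∘ z)) where

    -- At a solution of x′ᵢ = y(x′)ᵢ with values in A, z(x′) would represent the new integer.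
    ratio≢1 : ¬ (∀ i → coeff a y i - coeff a z i ≡ 1ℤ * a i)
    ratio≢1 d≡a = new (eval (proj₁ ∘ s) ∘ z) ((λ i → eval∈A s (z i)) , (begin
      linForm a (eval (proj₁ ∘ s) ∘ z)
        ≡⟨ add-sub _ (linForm a (eval (proj₁ ∘ s) ∘ y)) ⟩
      (linForm a (eval (proj₁ ∘ s) ∘ z) - linForm a (eval (proj₁ ∘ s) ∘ y)) + linForm a (eval (proj₁ ∘ s) ∘ y)
        ≡⟨ cong₂ _+_ (eval-relation y z y≡z 1ℤ d≡a (proj₁ ∘ s)) (linForm-congʳ a solved) ⟩
      1ℤ * (linForm a x - linForm a (proj₁ ∘ s)) + linForm a (proj₁ ∘ s)
        ≡⟨ sub-add (linForm a x) _ ⟩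
      linForm a x ∎))
      where
      open ≡-Reasoning
      solution = solve-system α∈A y
      s = proj₁ solution
      solved : ∀ i → eval (proj₁ ∘ s) (y i) ≡ proj₁ (s i)
      solved i = trans (proj₁-eval (y i)) (cong proj₁ (proj₂ solution i))
        where
        proj₁-eval : ∀ e → eval (proj₁ ∘ s) e ≡ proj₁ ([ s , id ]′ e)
        proj₁-eval (inj₁ k) = refl
        proj₁-eval (inj₂ c) = refl
      add-sub : ∀ p q → p ≡ (p - q) + q
      add-sub = solve-∀
      sub-add : ∀ p q → 1ℤ * (p - q) + q ≡ p
      sub-add p q = trans (cong (_+ q) (ℤ.*-identityˡ (p - q))) (sym (add-sub p q))

    module _ (m : ℕ) (d≡ca : ∀ i → coeff a y i - coeff a z i ≡ + suc (suc m) * a i) where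

      -- Pairing d with the signs of a shows that y and z together have mass at least 2 ‖a‖, so
      -- all of their entries are unknowns.
      mass-bound : ¬ (∣ linForm a (unknownPart (sgn ∘ a) ∘ y) ∣ ℕ.+ ∣ linForm a (unknownPart (sgn ∘ a) ∘ z) ∣
                        ℕ.< norm a ℕ.+ norm a)
      mass-bound small = ℕ.<-irrefl refl (begin-strict
        norm a ℕ.+ norm a                          ≤⟨ ℕ.+-monoʳ-≤ (norm a) (ℕ.m≤m+n (norm a) (m ℕ.* norm a)) ⟩
        suc (suc m) ℕ.* norm a                     ≡⟨ ℤ.abs-* (+ suc (suc m)) (+ norm a) ⟨
        ∣ + suc (suc m) * + norm a ∣               ≡⟨ cong (λ t → ∣ + suc (suc m) * t ∣) (linForm-sgn a) ⟨
        ∣ + suc (suc m) * linForm a (sgn ∘ a) ∣    ≡⟨ cong ∣_∣ (linForm-*ˡ (+ suc (suc m)) a (sgn ∘ a)) ⟨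
        ∣ linForm (λ i → + suc (suc m) * a i) (sgn ∘ a) ∣
          ≡⟨ cong ∣_∣ (linForm-congˡ (sgn ∘ a) d≡ca) ⟨
        ∣ linForm (λ i → coeff a y i - coeff a z i) (sgn ∘ a) ∣
          ≡⟨ cong ∣_∣ (coeff-difference y z (sgn ∘ a)) ⟩
        ∣ linForm a (unknownPart (sgn ∘ a) ∘ y) - linForm a (unknownPart (sgn ∘ a) ∘ z) ∣
          ≤⟨ ℤ.∣i-j∣≤∣i∣+∣j∣ (linForm a (unknownPart (sgn ∘ a) ∘ y)) _ ⟩
        ∣ linForm a (unknownPart (sgn ∘ a) ∘ y) ∣ ℕ.+ ∣ linForm a (unknownPart (sgn ∘ a) ∘ z) ∣
          <⟨ small ⟩
        norm a ℕ.+ norm a                          ∎)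
        where open ℕ.≤-Reasoning

      ∣unknownPart∣≤1 : ∀ e → ∣ unknownPart (sgn ∘ a) e ∣ ≤ 1
      ∣unknownPart∣≤1 (inj₁ k) = ∣sgn∣≤1 (a k)
      ∣unknownPart∣≤1 (inj₂ c) = z≤n

      mass≤ : ∀ y → ∣ linForm a (unknownPart (sgn ∘ a) ∘ y) ∣ ≤ norm a
      mass≤ y = ∣linForm∣≤norm a _ (∣unknownPart∣≤1 ∘ y)

      mass< : ∀ y → (∃₂ λ j c → y j ≡ inj₂ c) → ∣ linForm a (unknownPart (sgn ∘ a) ∘ y) ∣ ℕ.< norm a
      mass< y (j , c , yⱼ≡c) =
        ∣linForm∣<norm a _ a≢0 (∣unknownPart∣≤1 ∘ y) j (cong (unknownPart (sgn ∘ a)) yⱼ≡c)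

      ratio≱2 : ⊥
      ratio≱2 with all-inj₁⊎some-inj₂ y | all-inj₁⊎some-inj₂ z
      ... | inj₂ y∌ | _       = mass-bound (ℕ.+-mono-<-≤ (mass< y y∌) (mass≤ z))
      ... | inj₁ _  | inj₂ z∌ = mass-bound (ℕ.+-mono-≤-< (mass≤ y) (mass< z z∌))
      -- Under a constant substitution, `y` and `z` without constants evaluate identically, so
      -- `eval-relation` has left side 0 and the nonzero ratio can be cancelled.
      ... | inj₁ (f , y≡f) | inj₁ (g , z≡g) = new (const α) ((λ _ → proj₂ α∈A) , sym (ℤ.i-j≡0⇒i≡j _ _
        (ℤ.*-cancelˡ-≡ (+ suc (suc m)) _ _ (begin
          + suc (suc m) * (linForm a x - linForm a (const α))
            ≡⟨ eval-relation y z y≡z (+ suc (suc m)) d≡ca (const α) ⟨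
          linForm a (eval (const α) ∘ z) - linForm a (eval (const α) ∘ y)
            ≡⟨ ℤ.i≡j⇒i-j≡0 {linForm a (eval (const α) ∘ z)} (linForm-congʳ a λ j →
                 trans (cong (eval (const α)) (z≡g j)) (sym (cong (eval (const α)) (y≡f j)))) ⟩
          0ℤ
            ≡⟨ ℤ.*-zeroʳ (+ suc (suc m)) ⟨
          + suc (suc m) * 0ℤ ∎))))
        where
        open ≡-Reasoning
        α = proj₁ α∈A

    ratio≯0 : ∀ m → ¬ (∀ i → coeff a y i - coeff a z i ≡ + suc m * a i)
    ratio≯0 zero    = ratio≢1
    ratio≯0 (suc m) = ratio≱2 m

  -- Replacing every unknown by an element of A reduces the claim to uniqueness in A.
  equal-coeff⇒equivalent : ∀ y z → linForm a (eval x ∘ y) ≡ linForm a (eval x ∘ z) →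
    (∀ i → coeff a y i - coeff a z i ≡ 0ℤ * a i) → RepEquiv a (eval x ∘ y) (eval x ∘ z)
  equal-coeff⇒equivalent y z y≡z d≡0 ξ = begin
    weight a (eval x ∘ y) ξ
      ≡⟨ weight≡ a (eval x ∘ y) ξ ⟩
    linForm a (ind ξ ∘ eval x ∘ y)
      ≡⟨ shift y ⟩
    linForm (coeff a y) D + linForm a (ind ξ ∘ eval (const α) ∘ y)
      ≡⟨ cong₂ _+_ (linForm-congˡ D λ i → ℤ.i-j≡0⇒i≡j (coeff a y i) (coeff a z i) (d≡0 i)) at-α ⟩
    linForm (coeff a z) D + linForm a (ind ξ ∘ eval (const α) ∘ z)
      ≡⟨ shift z ⟨
    linForm a (ind ξ ∘ eval x ∘ z)
      ≡⟨ weight≡ a (eval x ∘ z) ξ ⟨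
    weight a (eval x ∘ z) ξ ∎
    where
    open ≡-Reasoning
    α = proj₁ α∈A
    D = λ i → ind ξ (x i) - ind ξ α
    add-sub : ∀ p q → p ≡ (p - q) + q
    add-sub = solve-∀
    -- Passing from `x` to the constant `α` changes a weight by an amount depending only on the
    -- coefficients, which agree for `y` and `z`.
    shift : ∀ y → linForm a (ind ξ ∘ eval x ∘ y) ≡
                  linForm (coeff a y) D + linForm a (ind ξ ∘ eval (const α) ∘ y)
    shift y = trans (add-sub _ (linForm a (ind ξ ∘ eval (const α) ∘ y)))
      (cong (_+ linForm a (ind ξ ∘ eval (const α) ∘ y)) (eval-difference a y (ind ξ) x (const α)))
    -- For ratio 0, `eval-relation` says that `y` and `z` also represent a common integer after
    -- substituting `α`, now with all entries in `A`.
    at-α : linForm a (ind ξ ∘ eval (const α) ∘ y) ≡ linForm a (ind ξ ∘ eval (const α) ∘ z)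
    at-α = begin
      linForm a (ind ξ ∘ eval (const α) ∘ y)  ≡⟨ weight≡ a (eval (const α) ∘ y) ξ ⟨
      weight a (eval (const α) ∘ y) ξ
        ≡⟨ unique _ _ _ (eval∈A (const α∈A) ∘ y , refl)
             (eval∈A (const α∈A) ∘ z , ℤ.i-j≡0⇒i≡j _ _ (eval-relation y z y≡z 0ℤ d≡0 (const α))) ξ ⟩
      weight a (eval (const α) ∘ z) ξ         ≡⟨ weight≡ a (eval (const α) ∘ z) ξ ⟩
      linForm a (ind ξ ∘ eval (const α) ∘ z)  ∎

  -- Exchanging `y` and `z` negates the ratio, so a negative ratio is excluded just as a positive
  -- one is.
  proportional⇒equivalent : ∀ y z → linForm a (eval x ∘ y) ≡ linForm a (eval x ∘ z) →
    (∃ λ c → ∀ i → coeff a y i - coeff a z i ≡ c * a i) → RepEquiv a (eval x ∘ y) (eval x ∘ z)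
  proportional⇒equivalent y z y≡z (+ zero , d≡) = equal-coeff⇒equivalent y z y≡z d≡
  proportional⇒equivalent y z y≡z (+ suc m , d≡) = contradiction d≡ (ratio≯0 y z y≡z m)
  proportional⇒equivalent y z y≡z (-[1+ m ] , d≡) = contradiction
    (λ i → trans (swap (coeff a y i) (coeff a z i)) (trans (cong -_ (d≡ i)) (ℤ.neg-distribˡ-* -[1+ m ] (a i))))
    (ratio≯0 z y (sym y≡z) m)
    where
    swap : ∀ p q → q - p ≡ - (p - q)
    swap = solve-∀

-- The greedy construction

-- The first entry runs through the finite list and the remaining value is decided recursively. The
-- greedy step can thus decide constructively whether an integer needs a new representation.
represented? : ∀ {k} (a : Fin k → ℤ) xs n → Dec (∃ λ x → IsRep a (_∈ xs) n x)
represented? {zero}  a xs n =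
  map′ (λ 0≡n → (λ ()) , (λ ()) , 0≡n) (λ { (_ , _ , 0≡n) → 0≡n }) (0ℤ ≟ n)
represented? {suc k} a xs n =
  map′ prepend (λ { (x , x∈ , ax≡n) → lose (x∈ zero) (x ∘ suc , x∈ ∘ suc , split (x zero) (x ∘ suc) ax≡n) })
    (any? (λ c → represented? (a ∘ suc) xs (n - a zero * c)) xs)
  where
  add-sub : ∀ p q → q ≡ (p + q) - p
  add-sub = solve-∀
  sub-add : ∀ p q → p + (q - p) ≡ q
  sub-add = solve-∀
  split : ∀ c x → a zero * c + linForm (a ∘ suc) x ≡ n → linForm (a ∘ suc) x ≡ n - a zero * c
  split c x eq = trans (add-sub (a zero * c) _) (cong (_- a zero * c) eq)
  prepend : Any (λ c → ∃ λ x → IsRep (a ∘ suc) (_∈ xs) (n - a zero * c) x) xs → ∃ λ x → IsRep a (_∈ xs) n x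
  prepend p with find p
  ... | c , c∈ , x , x∈ , ax≡ = c Vector.∷ x , (λ { zero → c∈ ; (suc i) → x∈ i }) ,
    trans (cong (λ t → a zero * c + t) ax≡) (sub-add (a zero * c) n)

bounded : (xs : List ℤ) → ∃ λ R → ∀ {c} → c ∈ xs → ∣ c ∣ ≤ R
bounded []       = 0 , λ ()
bounded (x ∷ xs) = ∣ x ∣ ℕ.⊔ proj₁ (bounded xs) , λ
  { (here refl) → ℕ.m≤m⊔n _ _
  ; (there c∈) → ℕ.≤-trans (proj₂ (bounded xs) c∈) (ℕ.m≤n⊔m _ _) }

-- `P` is the constraint on the elements: trivial for the first equivalence, a lower bound for the
-- second. The genericity bound `norm a ℕ.+ norm a` covers differences of two coefficient vectors.
module Greedy {h} (a : Fin h → ℤ) (a≢0 : ∀ i → a i ≢ 0ℤ)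
  (u : Fin h → ℤ) (au≡1 : linForm a u ≡ 1ℤ)
  (v : Fin h → ℤ) (av≡0 : linForm a v ≡ 0ℤ) (generic : Generic a (norm a ℕ.+ norm a) v)
  (P : Pred ℤ 0ℓ)
  (eventually-P : ∀ (b : Fin h → ℤ) → ∃ λ T₀ → ∀ T → T₀ ≤ T → ∀ i → P (b i + + T * v i)) where

  record Stage : Set where
    field
      elems    : List ℤ
      nonEmpty : ∃ (_∈ elems)
      all-P    : ∀ {c} → c ∈ elems → P c
      unique   : Unique a (_∈ elems)
  open Stage

  module _ (S : Stage) (n : ℤ) (n-new : ¬ ∃ λ x → IsRep a (_∈ elems S) n x) where

    private
      b : Fin h → ℤ
      b i = n * u i
      R = proj₁ (bounded (elems S)) ℕ.+ norm b
      T₀ = proj₁ (eventually-P b)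
      -- The first summand exceeds the difference of any two formal values at `b`; the second makes
      -- the new elements satisfy `P`.
      T = suc (norm a ℕ.* R ℕ.+ norm a ℕ.* R) ℕ.+ T₀
      x : Fin h → ℤ
      x i = b i + + T * v i

      ax≡n : linForm a x ≡ n
      ax≡n = begin
        linForm a x
          ≡⟨ linForm-+ʳ a b (λ i → + T * v i) ⟩
        linForm a b + linForm a (λ i → + T * v i)
          ≡⟨ cong₂ _+_ (linForm-*ʳ a n u) (linForm-*ʳ a (+ T) v) ⟩
        n * linForm a u + + T * linForm a v
          ≡⟨ cong₂ (λ p q → n * p + + T * q) au≡1 av≡0 ⟩
        n * 1ℤ + + T * 0ℤ
          ≡⟨ cong₂ _+_ (ℤ.*-identityʳ n) (ℤ.*-zeroʳ (+ T)) ⟩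
        n + 0ℤ
          ≡⟨ ℤ.+-identityʳ n ⟩
        n ∎
        where open ≡-Reasoning

      x-new : ∀ y → ¬ IsRep a (_∈ elems S) (linForm a x) y
      x-new y (y∈ , ay≡) = n-new (y , y∈ , trans ay≡ ax≡n)

      open Adjoin a a≢0 (_∈ elems S) (nonEmpty S) (unique S) x x-new

      ∣eval-b∣≤R : ∀ e → ∣ eval b e ∣ ≤ R
      ∣eval-b∣≤R (inj₁ k) = ℕ.≤-trans (∣aᵢ∣≤norm b k) (ℕ.m≤n+m _ _)
      ∣eval-b∣≤R (inj₂ (c , c∈)) = ℕ.≤-trans (proj₂ (bounded (elems S)) c∈) (ℕ.m≤m+n _ _)

      -- Only the unknowns move with `T`, so the value is affine in `T`, with slope the pairing of
      -- the coefficients with `v`.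
      eval-shift : ∀ y → linForm a (eval x ∘ y) ≡ linForm a (eval b ∘ y) + + T * linForm (coeff a y) v
      eval-shift y = begin
        linForm a (eval x ∘ y)
          ≡⟨ add-sub _ (linForm a (eval b ∘ y)) ⟩
        linForm a (eval b ∘ y) + (linForm a (eval x ∘ y) - linForm a (eval b ∘ y))
          ≡⟨ cong (λ t → linForm a (eval b ∘ y) + t) (eval-difference a y id x b) ⟩
        linForm a (eval b ∘ y) + linForm (coeff a y) (λ i → x i - b i)
          ≡⟨ cong (λ t → linForm a (eval b ∘ y) + t) (linForm-congʳ (coeff a y) λ i → cancel (b i) (+ T * v i)) ⟩
        linForm a (eval b ∘ y) + linForm (coeff a y) (λ i → + T * v i)
          ≡⟨ cong (λ t → linForm a (eval b ∘ y) + t) (linForm-*ʳ (coeff a y) (+ T) v) ⟩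
        linForm a (eval b ∘ y) + + T * linForm (coeff a y) v ∎
        where
        open ≡-Reasoning
        add-sub : ∀ p q → p ≡ q + (p - q)
        add-sub = solve-∀
        cancel : ∀ p q → (p + q) - p ≡ q
        cancel = solve-∀

      -- The parts free of `T` differ by less than `T`, so the slopes must agree; genericity of `v`
      -- then applies to the coefficient difference.
      coincidence⇒proportional : ∀ y z → linForm a (eval x ∘ y) ≡ linForm a (eval x ∘ z) →
        ∃ λ c → ∀ i → coeff a y i - coeff a z i ≡ c * a i
      coincidence⇒proportional y z y≡z = generic (λ i → coeff a y i - coeff a z i) d≤2∥a∥
        (proj₂ (remainder-zero T q (linForm (λ i → coeff a y i - coeff a z i) v) q<T vanishes))
        where
        q = linForm a (eval b ∘ y) - linForm a (eval b ∘ z)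
        d≤2∥a∥ : ∀ i → ∣ coeff a y i - coeff a z i ∣ ≤ norm a ℕ.+ norm a
        d≤2∥a∥ i = ℕ.≤-trans (ℤ.∣i-j∣≤∣i∣+∣j∣ (coeff a y i) (coeff a z i))
          (ℕ.+-mono-≤ (∣coeff∣≤norm a y i) (∣coeff∣≤norm a z i))
        q<T : ∣ q ∣ ℕ.< T
        q<T = s≤s (ℕ.≤-trans (ℤ.∣i-j∣≤∣i∣+∣j∣ (linForm a (eval b ∘ y)) (linForm a (eval b ∘ z)))
          (ℕ.≤-trans (ℕ.+-mono-≤ (∣linForm∣≤ a _ (∣eval-b∣≤R ∘ y)) (∣linForm∣≤ a _ (∣eval-b∣≤R ∘ z)))
            (ℕ.m≤m+n _ T₀)))
        regroup : ∀ p r t α β → (p - r) + t * (α - β) ≡ (p + t * α) - (r + t * β)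
        regroup = solve-∀
        vanishes : q + + T * linForm (λ i → coeff a y i - coeff a z i) v ≡ 0ℤ
        vanishes = begin
          q + + T * linForm (λ i → coeff a y i - coeff a z i) v
            ≡⟨ cong (λ t → q + + T * t) (linForm--ˡ (coeff a y) (coeff a z) v) ⟩
          q + + T * (linForm (coeff a y) v - linForm (coeff a z) v)
            ≡⟨ regroup (linForm a (eval b ∘ y)) (linForm a (eval b ∘ z)) (+ T) _ _ ⟩
          (linForm a (eval b ∘ y) + + T * linForm (coeff a y) v) -
          (linForm a (eval b ∘ z) + + T * linForm (coeff a z) v)
            ≡⟨ cong₂ _-_ (eval-shift y) (eval-shift z) ⟨
          linForm a (eval x ∘ y) - linForm a (eval x ∘ z)
            ≡⟨ ℤ.i≡j⇒i-j≡0 y≡z ⟩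
          0ℤ ∎
          where open ≡-Reasoning

      -- New elements may coincide with each other or with old ones, so the formal entry need not be
      -- unique; any choice serves, since only its value at `x` is used.
      formal : ∀ {c} → c ∈ elems S ++ tabulate x → ∃ λ e → eval x e ≡ c
      formal c∈ with ∈-++⁻ (elems S) c∈
      ... | inj₁ c∈S = inj₂ (_ , c∈S) , refl
      ... | inj₂ c∈x with ∈-tabulate⁻ c∈x
      ...   | k , c≡xₖ = inj₁ k , sym c≡xₖ

      all-P′ : ∀ {c} → c ∈ elems S ++ tabulate x → P c
      all-P′ c∈ with ∈-++⁻ (elems S) c∈
      ... | inj₁ c∈S = all-P S c∈S
      ... | inj₂ c∈x with ∈-tabulate⁻ c∈x
      ...   | k , c≡xₖ = subst P (sym c≡xₖ) (proj₂ (eventually-P b) T (ℕ.m≤n+m T₀ _) k)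

      unique′ : Unique a (_∈ elems S ++ tabulate x)
      unique′ m y z (y∈ , ay≡m) (z∈ , az≡m) ξ = begin
        weight a y ξ                    ≡⟨ weight-cong ŷ≡y ⟨
        weight a (eval x ∘ ŷ) ξ         ≡⟨ proportional⇒equivalent ŷ ẑ ŷ≡ẑ (coincidence⇒proportional ŷ ẑ ŷ≡ẑ) ξ ⟩
        weight a (eval x ∘ ẑ) ξ         ≡⟨ weight-cong ẑ≡z ⟩
        weight a z ξ                    ∎
        where
        open ≡-Reasoning
        weight-cong : ∀ {y z} → (∀ i → y i ≡ z i) → weight a y ξ ≡ weight a z ξ
        weight-cong {y} {z} y≡z = trans (weight≡ a y ξ)
          (trans (linForm-congʳ a (cong (ind ξ) ∘ y≡z)) (sym (weight≡ a z ξ)))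
        ŷ = proj₁ ∘ formal ∘ y∈
        ẑ = proj₁ ∘ formal ∘ z∈
        ŷ≡y : ∀ i → eval x (ŷ i) ≡ y i
        ŷ≡y = proj₂ ∘ formal ∘ y∈
        ẑ≡z : ∀ i → eval x (ẑ i) ≡ z i
        ẑ≡z = proj₂ ∘ formal ∘ z∈
        ŷ≡ẑ : linForm a (eval x ∘ ŷ) ≡ linForm a (eval x ∘ ẑ)
        ŷ≡ẑ = trans (trans (linForm-congʳ a ŷ≡y) ay≡m) (sym (trans (linForm-congʳ a ẑ≡z) az≡m))

    adjoin : ∃ λ S′ → elems S ⊆ elems S′ × (∃ λ y → IsRep a (_∈ elems S′) n y)
    adjoin = record
      { elems    = elems S ++ tabulate x
      ; nonEmpty = proj₁ (nonEmpty S) , ∈-++⁺ˡ (proj₂ (nonEmpty S))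
      ; all-P    = all-P′
      ; unique   = unique′
      } , ∈-++⁺ˡ , x , (λ i → ∈-++⁺ʳ (elems S) (∈-tabulate⁺ i)) , ax≡n

  extend : ∀ S n → ∃ λ S′ → elems S ⊆ elems S′ × (∃ λ y → IsRep a (_∈ elems S′) n y)
  extend S n with represented? a (elems S) n
  ... | yes n-rep = S , id , n-rep
  ... | no n-new  = adjoin S n n-new

  module _ (α : ℤ) (Pα : P α) where

    stage : ℕ → Stage
    stage zero = record
      { elems    = α ∷ []
      ; nonEmpty = α , here refl
      ; all-P    = λ { (here refl) → Pα }
      ; unique   = λ { _ x y (x∈ , _) (y∈ , _) ξ → trans (constant x x∈ ξ) (sym (constant y y∈ ξ)) }
      }
      where
      constant : ∀ x → (∀ i → x i ∈ α ∷ []) → ∀ ξ → weight a x ξ ≡ linForm a (const (ind ξ α))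
      constant x x∈ ξ = trans (weight≡ a x ξ) (linForm-congʳ a λ i → cong (ind ξ) (only (x∈ i)))
        where
        only : ∀ {c} → c ∈ α ∷ [] → c ≡ α
        only (here c≡α) = c≡α
    -- Both `+ k` and `- + k` are treated at this step, so every integer has its turn.
    stage (suc k) = proj₁ (extend (proj₁ (extend (stage k) (+ k))) (- + k))

    stage-step : ∀ k → elems (stage k) ⊆ elems (stage (suc k))
    stage-step k = proj₁ (proj₂ (extend (proj₁ (extend (stage k) (+ k))) (- + k)))
      ∘ proj₁ (proj₂ (extend (stage k) (+ k)))

    stage-mono : ∀ {k l} → k ℕ.≤′ l → elems (stage k) ⊆ elems (stage l)
    stage-mono ℕ.≤′-refl       c∈ = c∈
    stage-mono (ℕ.≤′-step k≤l) c∈ = stage-step _ (stage-mono k≤l c∈)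

    basis : Pred ℤ 0ℓ
    basis c = ∃ λ k → c ∈ elems (stage k)

    basis-P : ∀ c → basis c → P c
    basis-P c (k , c∈) = all-P (stage k) c∈

    -- A representation has finitely many entries and the stages increase; uniqueness in the union
    -- thus reduces to uniqueness in one stage.
    common-stage : ∀ {m} (x : Fin m → ℤ) → (∀ i → basis (x i)) → ∃ λ K → ∀ i → x i ∈ elems (stage K)
    common-stage {zero}  x x∈ = 0 , λ ()
    common-stage {suc m} x x∈ with x∈ zero | common-stage (x ∘ suc) (x∈ ∘ suc)
    ... | k , x₀∈ | K , xs∈ = k ℕ.⊔ K , λ
      { zero    → stage-mono (ℕ.≤⇒≤′ (ℕ.m≤m⊔n k K)) x₀∈
      ; (suc i) → stage-mono (ℕ.≤⇒≤′ (ℕ.m≤n⊔m k K)) (xs∈ i) }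

    represents+ : ∀ k → ∃ λ x → IsRep a basis (+ k) x
    represents+ k with proj₂ (proj₂ (extend (stage k) (+ k)))
    ... | x , x∈ , ax≡ = x , (λ i → suc k , proj₁ (proj₂ (extend (proj₁ (extend (stage k) (+ k))) (- + k))) (x∈ i)) , ax≡

    represents- : ∀ k → ∃ λ x → IsRep a basis (- + k) x
    represents- k with proj₂ (proj₂ (extend (proj₁ (extend (stage k) (+ k))) (- + k)))
    ... | x , x∈ , ax≡ = x , (λ i → suc k , x∈ i) , ax≡

    basis-uniqueRep : UniqueRepBasis a basis
    basis-uniqueRep n = existence n , uniqueness
      where
      existence : ∀ n → ∃ λ x → IsRep a basis n x
      existence (+ k)    = represents+ k
      -- `-[1+ k ]` is by computation `- + suc k`, hence the shift of index.
      existence -[1+ k ] = represents- (suc k)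
      uniqueness : ∀ x y → IsRep a basis n x → IsRep a basis n y → RepEquiv a x y
      uniqueness x y (x∈ , ax≡n) (y∈ , ay≡n) with common-stage x x∈ | common-stage y y∈
      ... | K , x∈K | L , y∈L = unique (stage (K ℕ.⊔ L)) n x y
        ((λ i → stage-mono (ℕ.≤⇒≤′ (ℕ.m≤m⊔n K L)) (x∈K i)) , ax≡n)
        ((λ i → stage-mono (ℕ.≤⇒≤′ (ℕ.m≤n⊔m K L)) (y∈L i)) , ay≡n)

-- Necessity of the conditions and the two equivalences

basis⇒primitive : ∀ {h} (a : Fin h → ℤ) A → UniqueRepBasis a A → Primitive a
basis⇒primitive a A basis with proj₁ (basis 1ℤ)
... | x , _ , ax≡1 = represents-1⇒primitive a x ax≡1

primitive⇒unit : ∀ {h} (a : Fin h → ℤ) → Primitive a → ∃ λ u → linForm a u ≡ 1ℤ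
primitive⇒unit a prim with linForm-bézout a
... | u , au≡gcd = u , trans au≡gcd (cong +_ prim)

eventually-U : ∀ {h} (v b : Fin h → ℤ) → ∃ λ T₀ → ∀ T → T₀ ≤ T → ∀ i → U (b i + + T * v i)
eventually-U v b = 0 , λ _ _ _ → tt

primitive⇒basis : ∀ {h} (a : Fin h → ℤ) → (∀ i → a i ≢ 0ℤ) → Primitive a →
  ∃ λ (A : Pred ℤ 0ℓ) → UniqueRepBasis a A
primitive⇒basis a a≢0 prim with primitive⇒unit a prim
... | u , au≡1 with generic-kernel a a≢0 u au≡1 (norm a ℕ.+ norm a)
...   | v , av≡0 , generic = basis 0ℤ tt , basis-uniqueRep 0ℤ tt
  where open Greedy a a≢0 u au≡1 v av≡0 generic U (eventually-U v)

-- As `v i` is at least 1, `T * v i` is at least `T`, which absorbs `∣ n ∣` and every `∣ b i ∣`.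
eventually-≥ : ∀ {h} (v : Fin h → ℤ) → (∀ i → 1ℤ ≤ℤ v i) → ∀ n b →
  ∃ λ T₀ → ∀ T → T₀ ≤ T → ∀ i → n ≤ℤ b i + + T * v i
eventually-≥ v v≥1 n b = ∣ n ∣ ℕ.+ norm b , λ T T₀≤T i → begin
  n                            ≡⟨ cancel n (b i) ⟩
  b i + (n - b i)              ≤⟨ ℤ.+-monoʳ-≤ (b i) (i≤+∣i∣ (n - b i)) ⟩
  b i + + ∣ n - b i ∣          ≤⟨ ℤ.+-monoʳ-≤ (b i) (+≤+ (ℕ.≤-trans (ℤ.∣i-j∣≤∣i∣+∣j∣ n (b i))
                                    (ℕ.≤-trans (ℕ.+-monoʳ-≤ ∣ n ∣ (∣aᵢ∣≤norm b i)) T₀≤T))) ⟩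
  b i + + T                    ≤⟨ ℤ.+-monoʳ-≤ (b i) (n≤n*i T (v≥1 i)) ⟩
  b i + + T * v i              ∎
  where
  open ℤ.≤-Reasoning
  cancel : ∀ p q → p ≡ q + (p - q)
  cancel = solve-∀

mixed⇒basis≥ : ∀ {h} (a : Fin h → ℤ) → (∀ i → a i ≢ 0ℤ) → Primitive a → ¬ SameSign a →
  ∀ n → ∃ λ (A : Pred ℤ 0ℓ) → UniqueRepBasis a A × (∀ x → A x → n ≤ℤ x)
mixed⇒basis≥ a a≢0 prim mixed n
  with u , au≡1 ← primitive⇒unit a prim
  with v , av≡0 , generic ← generic-kernel a a≢0 u au≡1 (norm a ℕ.+ norm a)
  with w , aw≡0 , w≥1 ← positive-kernel a a≢0 mixed
  with v′ , av′≡0 , generic′ , v′≥1 ← generic-positive-kernel a v w av≡0 generic aw≡0 w≥1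
  = basis n ℤ.≤-refl , basis-uniqueRep n ℤ.≤-refl , basis-P n ℤ.≤-refl
  where open Greedy a a≢0 u au≡1 v′ av′≡0 generic′ (n ≤ℤ_) (eventually-≥ v′ v′≥1 n)

0≤i*j : ∀ {i j} → 0ℤ ≤ℤ i → 0ℤ ≤ℤ j → 0ℤ ≤ℤ i * j
0≤i*j {i} 0≤i@(+≤+ _) 0≤j = subst (_≤ℤ i * _) (ℤ.*-zeroʳ i) (ℤ.*-monoˡ-≤-nonNeg i 0≤j)

-- On non-negative entries a form with positive coefficients misses -1, and one with negative
-- coefficients misses 1.
nonNegative-basis⇒mixed : ∀ {h} (a : Fin h → ℤ) A → UniqueRepBasis a A →
  (∀ x → A x → 0ℤ ≤ℤ x) → ¬ SameSign a
nonNegative-basis⇒mixed a A basis A≥0 (inj₁ a>0) with proj₁ (basis -1ℤ)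
... | x , x∈ , ax≡-1 = contradiction
  (subst (0ℤ ≤ℤ_) ax≡-1 (0≤sumFin _ λ i → 0≤i*j (ℤ.<⇒≤ (a>0 i)) (A≥0 _ (x∈ i)))) λ ()
nonNegative-basis⇒mixed a A basis A≥0 (inj₂ a<0) with proj₁ (basis 1ℤ)
... | x , x∈ , ax≡1 = contradiction (subst (0ℤ ≤ℤ_) [-a]x≡-1 (0≤sumFin _ λ i →
  0≤i*j (ℤ.neg-mono-≤ (ℤ.<⇒≤ (a<0 i))) (A≥0 _ (x∈ i)))) λ ()
  where
  [-a]x≡-1 : linForm (λ i → - a i) x ≡ -1ℤ
  [-a]x≡-1 = begin
    linForm (λ i → - a i) x      ≡⟨ linForm-congˡ x (λ i → ℤ.-1*i≡-i (a i)) ⟨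
    linForm (λ i → -1ℤ * a i) x  ≡⟨ linForm-*ˡ -1ℤ a x ⟩
    -1ℤ * linForm a x            ≡⟨ cong (-1ℤ *_) ax≡1 ⟩
    -1ℤ                          ∎
    where open ≡-Reasoning

theorem2p1 : (h : ℕ) → 1 ≤ h → (a : Fin h → ℤ) → (∀ i → a i ≢ 0ℤ) →
    ((∃ λ (A : Pred ℤ 0ℓ) → UniqueRepBasis a A) ⇔ Primitive a)
    × ((Primitive a × ¬ SameSign a)
    ⇔ (∀ (n : ℤ) → ∃ λ (A : Pred ℤ 0ℓ) → UniqueRepBasis a A × (∀ x → A x → n ≤ℤ x)))
theorem2p1 h _ a a≢0 =
  mk⇔ (λ { (A , basis) → basis⇒primitive a A basis }) (primitive⇒basis a a≢0) ,
  mk⇔ (λ { (prim , mixed) → mixed⇒basis≥ a a≢0 prim mixed }) (λ bases → necessary (bases 0ℤ))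
  where
  necessary : (∃ λ (A : Pred ℤ 0ℓ) → UniqueRepBasis a A × (∀ x → A x → 0ℤ ≤ℤ x)) →
    Primitive a × ¬ SameSign a
  necessary (A , basis , A≥0) = basis⇒primitive a A basis , nonNegative-basis⇒mixed a A basis A≥0
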